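{- Let $\Lambda$ be a set and let $\to:\Lambda\times\Lambda\to\mathbb{N}$ be a function such that for every $a\in\Lambda$ the set $\{b\in\Lambda \mid \to(a,b)\neq 0\}$ is finite. Let $\Omega$ be the set of strategies, $\mathtt{P}:\mathcal{P}(\Omega)\to[0,1]$ the set function, and $\mathcal{A}\subseteq\mathcal{P}(\Omega)$ the family of measurable sets associated with $(\Lambda,\to)$ (all defined in the context). Then $(\Omega,\mathcal{A},\mathtt{P})$ (with $\mathtt{P}$ restricted to $\mathcal{A}$) is a probability space.
   Context: Elements of $\Lambda$ are called objects. Write $a\to b$ if $\to(a,b)\neq 0$. The degree of $a\in\Lambda$ is $\rho(a)=\sum_{b}\to(a,b)\in\mathbb{N}$, and $\Lambda^+=\{a\in\Lambda\mid \rho(a)\geq 1\}$ is the set of non-normal objects. A strategy is a total function $f:\Lambda^+\to\Lambda$ such that $f(a)=b$ implies $a\to b$; $\Omega$ is the set of all strategies. A box is a subset $B\subseteq\Omega$ of the form $B=\{f\in\Omega\mid f(a_1)=a_1',\dots,f(a_n)=a_n'\}$ with $n\ge 0$, $a_1,\dots,a_n\in\Lambda^+$ pairwise distinct and $a_1',\dots,a_n'\in\Lambda$ (for $n=0$, $B=\Omega$). For such a box put $\mathtt{p}(B)=\prod_{i=1}^n\frac{\to(a_i,a_i')}{\rho(a_i)}$, the empty product being $1$; by convention $\mathtt{p}(\emptyset)=0$. For $S\subseteq\Omega$: $\mathtt{P}(\emptyset)=0$, and for $S\ne\emptyset$, $\mathtt{P}(S)=\inf\{\sum_{B\in\mathcal{C}}\mathtt{p}(B)\mid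 \mathcal{C}$ is a countable family of boxes with $S\subseteq\bigcup_{B\in\mathcal{C}}B\}$ (finite families count as countable). A set $A\subseteq\Omega$ is (Lebesgue) measurable if for all $S\subseteq\Omega$, $\mathtt{P}(S)=\mathtt{P}(S\cap A)+\mathtt{P}(S\cap(\Omega\setminus A))$; $\mathcal{A}$ is the set of all measurable subsets of $\Omega$. -}

module Defs where

open import Axiom.ExcludedMiddle using (ExcludedMiddle)
import Data.Integer.Base as ℤ
open import Data.List.Base using (List; []; _∷_; map; foldr; sum)
open import Data.List.Membership.Propositional using (_∈_)
open import Data.List.Relation.Unary.All using (All; []; _∷_)
import Data.List.Relation.Unary.All as All
import Data.List.Relation.Unary.AllPairs as AllPairs
import Data.List.Relation.Unary.All.Properties as All
open import Data.List.Relation.Unary.Any using (Any; here; there)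
open import Data.List.Relation.Unary.Unique.Propositional using (Unique)
open import Data.Maybe.Base using (Maybe; just; nothing; maybe′)
open import Data.Nat.Base using (ℕ; zero; suc; >-nonZero)
import Data.Nat.Base as ℕ
import Data.Nat.Properties as ℕ
open import Data.Product.Base using (Σ-syntax; ∃-syntax; _×_; _,_; proj₁; proj₂)
open import Data.Rational.Base
  using (ℚ; 0ℚ; 1ℚ; _+_; _*_; _-_; -_; _/_; _<_; NonNegative)
open import Data.Rational.Properties
open import Function.Bundles using (_⇔_; module Equivalence)
open import Level using (0ℓ)
open import Relation.Binary.Bundles using (Setoid)
open import Relation.Binary.PropositionalEquality
  using (_≡_; _≢_; refl; sym; trans; cong; subst)
open import Relation.Nullary using (¬_; Dec; yes; no; ¬?; contradiction)
import Relation.Unary as U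
open U using (Pred)

------------------------------------------------------------------------
-- Extended non-negative real numbers

-- x ∈ [0,∞] is given by the lower Dedekind cut { q ∈ ℚ | q < x }: a
-- downward closed set of rationals without greatest element that contains
-- all negative rationals. The full cut is ∞. Classically these are
-- exactly the elements of [0,∞].

record [0,∞] : Set₁ where
  field
    below    : Pred ℚ 0ℓ
    negative : ∀ {q} → q < 0ℚ → below q
    down     : ∀ {p q} → p < q → below q → below p
    open′    : ∀ {p} → below p → ∃[ q ] p < q × below q

open [0,∞] public

infix 4 _≃_ _≤∞_
infixl 6 _+∞_

_≃_ : [0,∞] → [0,∞] → Set
x ≃ y = below x U.≐ below y

_≤∞_ : [0,∞] → [0,∞] → Set
x ≤∞ y = below x U.⊆ below y

fromℚ : (q : ℚ) → .{{NonNegative q}} → [0,∞]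
fromℚ q = record
  { below    = _< q
  ; negative = λ p<0 → <-≤-trans p<0 (nonNegative⁻¹ q)
  ; down     = <-trans
  ; open′    = λ p<q → let m , p<m , m<q = <-dense p<q in m , p<m , m<q
  }

0∞ 1∞ : [0,∞]
0∞ = fromℚ 0ℚ
1∞ = fromℚ 1ℚ

private
  p-s+s≡p : ∀ p s → p - s + s ≡ p
  p-s+s≡p p s = trans (+-assoc p (- s) s)
    (trans (cong (p +_) (+-inverseˡ s)) (+-identityʳ p))

  r+s-s≡r : ∀ r s → r + s - s ≡ r
  r+s-s≡r r s = trans (+-assoc r s (- s))
    (trans (cong (r +_) (+-inverseʳ s)) (+-identityʳ r))

_+∞_ : [0,∞] → [0,∞] → [0,∞]
x +∞ y = record
  { below    = λ q → ∃[ r ] ∃[ s ] below x r × below y s × q ≡ r + s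
  ; negative = λ {q} q<0 →
      let m , q<m , m<0 = <-dense q<0 in
      q - m , m
      , negative x (subst (q - m <_) (+-inverseʳ m) (+-monoˡ-< (- m) q<m))
      , negative y m<0
      , sym (p-s+s≡p q m)
  ; down     = λ { {p} p<q (r , s , r<x , s<y , refl) →
      p - s , s
      , down x (subst (p - s <_) (r+s-s≡r r s) (+-monoˡ-< (- s) p<q)) r<x
      , s<y
      , sym (p-s+s≡p p s) }
  ; open′    = λ { (r , s , r<x , s<y , refl) →
      let r′ , r<r′ , r′<x = open′ x r<x in
      r′ + s , +-monoˡ-< s r<r′ , r′ , s , r′<x , s<y , refl }
  }

partialSum : (ℕ → [0,∞]) → ℕ → [0,∞]
partialSum x zero    = 0∞
partialSum x (suc n) = partialSum x n +∞ x n

-- The sum of a series with terms in [0,∞], as the supremum (union of the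
-- cuts) of its partial sums.

Σ∞ : (ℕ → [0,∞]) → [0,∞]
Σ∞ x = record
  { below    = λ q → ∃[ n ] below (partialSum x n) q
  ; negative = λ q<0 → zero , q<0
  ; down     = λ { p<q (n , q<s) → n , down (partialSum x n) p<q q<s }
  ; open′    = λ { (n , p<s) →
      let q , p<q , q<s = open′ (partialSum x n) p<s in q , p<q , n , q<s }
  }

-- The infimum: q < inf x iff some q′ > q is below every x i. (The
-- intersection of the cuts alone may have a greatest element.)

inf : {I : Set} → (I → [0,∞]) → [0,∞]
inf x = record
  { below    = λ q → ∃[ q′ ] q < q′ × (∀ i → below (x i) q′)
  ; negative = λ q<0 →
      let m , q<m , m<0 = <-dense q<0 in m , q<m , λ i → negative (x i) m<0
  ; down     = λ { p<q (q′ , q<q′ , q′<x) → q′ , <-trans p<q q<q′ , q′<x }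
  ; open′    = λ { (q′ , p<q′ , q′<x) →
      let m , p<m , m<q′ = <-dense p<q′ in m , p<m , q′ , m<q′ , q′<x }
  }

------------------------------------------------------------------------
-- Subsets and probability spaces

-- Without function extensionality a set of functions is a setoid, and its
-- subsets are the predicates that respect the setoid equality.

record Subset (X : Setoid 0ℓ 0ℓ) : Set₁ where
  open Setoid X
  field
    pred : Pred Carrier 0ℓ
    resp : ∀ {x y} → x ≈ y → pred x → pred y

open Subset public

module _ {X : Setoid 0ℓ 0ℓ} where
  open Setoid X using (Carrier) renaming (sym to ≈-sym)

  infix 4 _∋_ _⊆_ _≐_
  infixr 7 _∩_

  _∋_ : Subset X → Carrier → Set
  A ∋ x = pred A x

  _⊆_ _≐_ : Subset X → Subset X → Set
  A ⊆ B = pred A U.⊆ pred B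
  A ≐ B = pred A U.≐ pred B

  Disjoint : Subset X → Subset X → Set
  Disjoint A B = ∀ {x} → A ∋ x → ¬ (B ∋ x)

  ∅ full : Subset X
  ∅    = record { pred = U.∅ ; resp = λ _ () }
  full = record { pred = U.U ; resp = λ _ u → u }

  ∁ : Subset X → Subset X
  ∁ A = record
    { pred = U.∁ (pred A)
    ; resp = λ x≈y x∉A y∈A → x∉A (resp A (≈-sym x≈y) y∈A)
    }

  _∩_ : Subset X → Subset X → Subset X
  A ∩ B = record
    { pred = pred A U.∩ pred B
    ; resp = λ x≈y (a , b) → resp A x≈y a , resp B x≈y b
    }

  ⋃ : (ℕ → Subset X) → Subset X
  ⋃ A = record
    { pred = λ x → ∃[ n ] A n ∋ x
    ; resp = λ x≈y (n , a) → n , resp (A n) x≈y a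
    }

record IsσAlgebra (X : Setoid 0ℓ 0ℓ) (𝒜 : Subset X → Set₁) : Set₁ where
  field
    𝒜-resp-≐ : ∀ {A B} → A ≐ B → 𝒜 A → 𝒜 B
    full∈𝒜   : 𝒜 full
    ∁∈𝒜      : ∀ {A} → 𝒜 A → 𝒜 (∁ A)
    ⋃∈𝒜      : ∀ {A : ℕ → Subset X} → (∀ n → 𝒜 (A n)) → 𝒜 (⋃ A)

record IsProbabilitySpace (X : Setoid 0ℓ 0ℓ) (𝒜 : Subset X → Set₁)
                          (μ : ∀ A → 𝒜 A → [0,∞]) : Set₁ where
  field
    isσAlgebra : IsσAlgebra X 𝒜
  open IsσAlgebra isσAlgebra public
  field
    μ-cong     : ∀ {A B} (a : 𝒜 A) (b : 𝒜 B) → A ≐ B → μ A a ≃ μ B b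
    μ≤1        : ∀ {A} (a : 𝒜 A) → μ A a ≤∞ 1∞
    μ-∅        : ∀ (e : 𝒜 ∅) → μ ∅ e ≃ 0∞
    σ-additive : ∀ {A : ℕ → Subset X} (a : ∀ n → 𝒜 (A n)) →
                 (∀ {m n} → m ≢ n → Disjoint (A m) (A n)) →
                 μ (⋃ A) (⋃∈𝒜 a) ≃ Σ∞ (λ n → μ (A n) (a n))
    μ-full     : μ full full∈𝒜 ≃ 1∞

------------------------------------------------------------------------
-- Strategies

IsFinite : {A : Set} → Pred A 0ℓ → Set
IsFinite P = Σ[ xs ∈ List _ ] Unique xs × (∀ x → x ∈ xs ⇔ P x)

-- w a b is the multiplicity →(a,b).

module Strategies (Λ : Set) (w : Λ → Λ → ℕ)
                  (finite : ∀ a → IsFinite (λ b → w a b ≢ 0)) where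

  ρ : Λ → ℕ
  ρ a = sum (map (w a) (proj₁ (finite a)))

  -- Proofs of an inequality in ℕ are unique, so equality in Λ⁺ is equality
  -- of the underlying objects.

  Λ⁺ : Set
  Λ⁺ = Σ[ a ∈ Λ ] 1 ℕ.≤ ρ a

  record Strategy : Set where
    field
      next : Λ⁺ → Λ
      step : ∀ a → w (proj₁ a) (next a) ≢ 0

  open Strategy public

  Ω : Setoid 0ℓ 0ℓ
  Ω = record
    { Carrier       = Strategy
    ; _≈_           = λ f g → ∀ a → next f a ≡ next g a
    ; isEquivalence = record
      { refl  = λ _ → refl
      ; sym   = λ f≈g a → sym (f≈g a)
      ; trans = λ f≈g g≈h a → trans (f≈g a) (g≈h a)
      }
    }

  -- A box is presented by its list of constraints (aᵢ , aᵢ′). The value p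
  -- does not depend on the presentation of a non-empty box, because a
  -- constraint that holds for every strategy contributes the factor 1. An
  -- empty box has a constraint with w aᵢ aᵢ′ ≡ 0, hence p = 0; see p-empty.

  record Box : Set where
    field
      constraints : List (Λ⁺ × Λ)
      distinct    : Unique (map proj₁ constraints)

  open Box public

  ⟦_⟧ : Box → Subset Ω
  ⟦ B ⟧ = record
    { pred = λ f → All (λ (a , a′) → next f a ≡ a′) (constraints B)
    ; resp = λ f≈g → All.map (λ {(a , _)} fa≡a′ → trans (sym (f≈g a)) fa≡a′)
    }

  factor : Λ⁺ × Λ → ℚ
  factor ((a , 1≤ρa) , a′) = _/_ (ℤ.+ w a a′) (ρ a) {{>-nonZero 1≤ρa}}

  product : List (Λ⁺ × Λ) → ℚ
  product cs = foldr _*_ 1ℚ (map factor cs)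

  product-nonNeg : ∀ cs → NonNegative (product cs)
  product-nonNeg []       = _
  product-nonNeg (c@((a , 1≤ρa) , a′) ∷ cs) =
    nonNeg*nonNeg⇒nonNeg (factor c)
      {{normalize-nonNeg (w a a′) (ρ a) {{>-nonZero 1≤ρa}}}}
      (product cs) {{product-nonNeg cs}}

  p : Box → [0,∞]
  p B = fromℚ (product (constraints B)) {{product-nonNeg (constraints B)}}

  -- Countable families, finite and empty ones included: the indices n with
  -- C n ≡ nothing carry no box.

  Family : Set
  Family = ℕ → Maybe Box

  Covers : Family → Subset Ω → Set
  Covers C S = ∀ {f} → S ∋ f → ∃[ n ] ∃[ B ] C n ≡ just B × ⟦ B ⟧ ∋ f

  total : Family → [0,∞]
  total C = Σ∞ (λ n → maybe′ p 0∞ (C n))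

  -- The empty family covers ∅, so this formula also gives P ∅ = 0; see P-∅.

  P : Subset Ω → [0,∞]
  P S = inf {I = Σ[ C ∈ Family ] Covers C S} (λ (C , _) → total C)

  Measurable : Subset Ω → Set₁
  Measurable A = ∀ S → P S ≃ P (S ∩ A) +∞ P (S ∩ ∁ A)

  P-∅ : P ∅ ≃ 0∞
  P-∅ = (λ (q′ , q<q′ , q′<totals) →
           let n , q′<s = q′<totals ((λ _ → nothing) , λ ())
           in <-trans q<q′ (zeros n q′<s))
      , negative (P ∅)
    where
    zeros : ∀ n {q} → below (partialSum (λ _ → 0∞) n) q → q < 0ℚ
    zeros zero    q<0 = q<0
    zeros (suc n) (r , s , r<0 , s<0 , refl) = +-mono-< (zeros n r<0) s<0

  module _ (em : ExcludedMiddle 0ℓ) where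
    private
      successor : (a : Λ⁺) → ∃[ b ] w (proj₁ a) b ≢ 0
      successor (a , 1≤ρa) with finite a | 1≤ρa
      ... | []    , _ , _   | ()
      ... | b ∷ _ , _ , b∈⇔ | _ = b , Equivalence.to (b∈⇔ b) (here refl)

      Nonzero : Λ⁺ × Λ → Set
      Nonzero ((a , _) , a′) = w a a′ ≢ 0

      choose : ∀ cs → All Nonzero cs → (a : Λ⁺) → ∃[ b ] w (proj₁ a) b ≢ 0
      choose []              []         a = successor a
      choose ((k , k′) ∷ cs) (k≢0 ∷ nz) a with em {k ≡ a}
      ... | yes refl = k′ , k≢0
      ... | no  _    = choose cs nz a

      chosen : ∀ cs (nz : All Nonzero cs) → Unique (map proj₁ cs) →
               All (λ (a , a′) → proj₁ (choose cs nz a) ≡ a′) cs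
      chosen []              []         _           = []
      chosen ((k , k′) ∷ cs) (k≢0 ∷ nz) (k∉ AllPairs.∷ u) =
        head ∷ All.zipWith tail (All.map⁻ k∉ , chosen cs nz u)
        where
        head : proj₁ (choose ((k , k′) ∷ cs) (k≢0 ∷ nz) k) ≡ k′
        head with em {k ≡ k}
        ... | yes refl = refl
        ... | no  k≢k  = contradiction refl k≢k

        tail : ∀ {c} → k ≢ proj₁ c × proj₁ (choose cs nz (proj₁ c)) ≡ proj₂ c →
               proj₁ (choose ((k , k′) ∷ cs) (k≢0 ∷ nz) (proj₁ c)) ≡ proj₂ c
        tail {a , _} (k≢a , eq) with em {k ≡ a}
        ... | yes refl = contradiction refl k≢a
        ... | no  _    = eq

      product≡0 : ∀ cs → Any (λ c → ¬ Nonzero c) cs → product cs ≡ 0ℚ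
      product≡0 (c@((a , 1≤ρa) , a′) ∷ cs) (here ¬nz) with w a a′ ℕ.≟ 0
      ... | yes w≡0 = trans (cong (_* product cs) factor≡0) (*-zeroˡ (product cs))
        where
        factor≡0 : factor c ≡ 0ℚ
        factor≡0 = trans
          (cong (λ m → _/_ (ℤ.+ m) (ρ a) {{>-nonZero 1≤ρa}}) w≡0)
          (0/n≡0 (ρ a) {{>-nonZero 1≤ρa}})
      ... | no  w≢0 = contradiction w≢0 ¬nz
      product≡0 (c ∷ cs) (there any) =
        trans (cong (factor c *_) (product≡0 cs any)) (*-zeroʳ (factor c))

    p-empty : ∀ B → (∀ f → ¬ (⟦ B ⟧ ∋ f)) → p B ≃ 0∞
    p-empty B empty with All.all? nonzero? (constraints B)
      where
      nonzero? : ∀ c → Dec (Nonzero c)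
      nonzero? ((a , _) , a′) = ¬? (w a a′ ℕ.≟ 0)
    ... | yes nz = contradiction (chosen (constraints B) nz (distinct B)) (empty f)
      where
      f : Strategy
      f = record { next = λ a → proj₁ (choose (constraints B) nz a)
                 ; step = λ a → proj₂ (choose (constraints B) nz a) }
    ... | no ¬nz = subst (_ <_) eq , subst (_ <_) (sym eq)
      where
      eq : product (constraints B) ≡ 0ℚ
      eq = product≡0 (constraints B) (All.¬All⇒Any¬ (λ _ → em) (constraints B) ¬nz)

{-# OPTIONS --safe #-}
module Submission where

-- P is an outer measure of total mass 1, so Carathéodory's theorem turns
-- its measurable sets into a probability space. Boxes need not be shown
-- measurable.
--
-- Excluded middle decides every small type, Σ-types included, and a
-- positive decision yields a witness. It therefore acts as a choice
-- operator and supplies the countable choices below.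
--
-- Carathéodory's theorem (module Carathéodory). For measurable A₀, A₁, …
-- and any S put R₀ = S and Rₙ₊₁ = Rₙ ∖ Aₙ. Measurability of Aₙ, tested on
-- Rₙ, gives by induction
--   Σ_{i<n} μ (Rᵢ ∩ Aᵢ) + μ Rₙ ≤ μ S,
-- which is pieces+rest≤. The pieces Rᵢ ∩ Aᵢ cover S ∩ ⋃ A, so countable
-- subadditivity yields closure under countable unions; and if the Aₙ are
-- disjoint and S = ⋃ A, then Aᵢ ⊆ Rᵢ ∩ Aᵢ, which yields σ-additivity.
--
-- Countable subadditivity (P-subadditive). Given δ > 0, choose for each n a
-- cover of Aₙ whose total exceeds P Aₙ by at most δ / 2ⁿ⁺¹ and merge all these covers
-- into one, enumerating ℕ × ℕ along the boundaries of growing squares.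
--
-- Total mass 1 (P-full≥1). Let C be a family of boxes with total at most
-- q < 1. A partial assignment σ of successors to objects replaces the
-- probability of a box by its conditional probability given σ. If a is not
-- assigned, the conditional total given σ is the mean, with the weights
-- of a, of the conditional totals given σ together with a ↦ b. Hence some
-- successor b of a keeps the total at most q (extend). Assigning in this
-- way the objects constrained by box 0, box 1, … produces in the limit a
-- strategy. If it lay in box n, then that box would have conditional
-- probability 1 after finitely many steps, against the bound q < 1. So C
-- does not cover all strategies. This argument replaces compactness and
-- puts no restriction on the cardinality of the set of objects.

open import Defs
open import Axiom.ExcludedMiddle using (ExcludedMiddle)
import Data.Integer.Base as ℤ
import Data.Integer.Properties as ℤ
open import Data.List.Base using (List; []; _∷_; _++_; map; foldr; downFrom)
open import Data.List.Membership.Propositional using (_∈_; _∉_)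
open import Data.List.Membership.Propositional.Properties
  using (∈-map⁺; ∈-++⁺ˡ; ∈-++⁺ʳ; ∈-downFrom⁺)
open import Data.List.Relation.Unary.All using (All; []; _∷_)
import Data.List.Relation.Unary.All as All
import Data.List.Relation.Unary.All.Properties as All
open import Data.List.Relation.Unary.AllPairs using ([]; _∷_)
open import Data.List.Relation.Unary.Any using (here; there)
open import Data.List.Relation.Unary.Unique.Propositional using (Unique)
open import Data.Maybe.Base using (Maybe; just; nothing; maybe′)
open import Data.Maybe.Properties using (just-injective)
open import Data.Nat.Base using (ℕ; zero; suc)
import Data.Nat.Base as ℕ
open import Data.Nat.ListAction using (sum)
import Data.Nat.Properties as ℕ
open import Data.Product.Base using (Σ-syntax; ∃-syntax; _×_; _,_; proj₁; proj₂; map₂)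
open import Data.Rational.Base
  using (ℚ; 0ℚ; 1ℚ; ½; mkℚ; _+_; _*_; _-_; -_; _/_; _<_; _≤_; toℚᵘ; nonNegative; positive)
open import Data.Rational.Properties
open import Data.Rational.Solver using (module +-*-Solver)
import Data.Rational.Unnormalised.Base as ℚᵘ
import Data.Rational.Unnormalised.Properties as ℚᵘ
open import Data.Sum.Base using (_⊎_; inj₁; inj₂)
open import Function.Base using (_∘_; id)
open import Function.Bundles using (module Equivalence)
open import Level using (0ℓ)
open import Relation.Binary.Bundles using (Setoid)
open import Relation.Binary.PropositionalEquality
  using (_≡_; _≢_; refl; sym; trans; cong; cong₂; subst; module ≡-Reasoning)
open import Relation.Nullary using (¬_; Dec; yes; no; contradiction)
open import Relation.Nullary.Decidable using (decidable-stable)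
import Relation.Unary as U

open +-*-Solver using (solve; _:+_; _:-_; _:*_; _:=_; con)

private variable
  A B : Set
  x x′ y y′ : [0,∞]

------------------------------------------------------------------------
-- Finite sums of rational numbers

-- The sum of f x over the entries x of a list, with multiplicity.

∑ : List A → (A → ℚ) → ℚ
∑ []       f = 0ℚ
∑ (x ∷ xs) f = f x + ∑ xs f

∑-cong : ∀ (xs : List A) {f g} → (∀ {x} → x ∈ xs → f x ≡ g x) → ∑ xs f ≡ ∑ xs g
∑-cong []       f≡g = refl
∑-cong (x ∷ xs) f≡g = cong₂ _+_ (f≡g (here refl)) (∑-cong xs (f≡g ∘ there))

∑-mono : ∀ (xs : List A) {f g} → (∀ {x} → x ∈ xs → f x ≤ g x) → ∑ xs f ≤ ∑ xs g
∑-mono []       f≤g = ≤-refl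
∑-mono (x ∷ xs) f≤g = +-mono-≤ (f≤g (here refl)) (∑-mono xs (f≤g ∘ there))

∑-0 : ∀ (xs : List A) → ∑ xs (λ _ → 0ℚ) ≡ 0ℚ
∑-0 []       = refl
∑-0 (x ∷ xs) = trans (+-identityˡ _) (∑-0 xs)

∑-nonNeg : ∀ (xs : List A) {f} → (∀ x → 0ℚ ≤ f x) → 0ℚ ≤ ∑ xs f
∑-nonNeg xs 0≤f = subst (_≤ ∑ xs _) (∑-0 xs) (∑-mono xs (λ {x} _ → 0≤f x))

term≤∑ : ∀ {xs : List A} {f x} → (∀ y → 0ℚ ≤ f y) → x ∈ xs → f x ≤ ∑ xs f
term≤∑ {xs = x ∷ xs} {f} 0≤f (here refl) =
  subst (_≤ f x + ∑ xs f) (+-identityʳ (f x)) (+-monoʳ-≤ (f x) (∑-nonNeg xs 0≤f))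
term≤∑ {xs = x ∷ xs} {f} {y} 0≤f (there x∈xs) =
  subst (_≤ f x + ∑ xs f) (+-identityˡ (f y)) (+-mono-≤ (0≤f x) (term≤∑ 0≤f x∈xs))

∑-*ˡ : ∀ c (xs : List A) {f} → ∑ xs (λ x → c * f x) ≡ c * ∑ xs f
∑-*ˡ c []       = sym (*-zeroʳ c)
∑-*ˡ c (x ∷ xs) {f} = trans (cong (c * f x +_) (∑-*ˡ c xs))
  (sym (*-distribˡ-+ c (f x) (∑ xs f)))

∑-*ʳ : ∀ (xs : List A) {f} c → ∑ xs (λ x → f x * c) ≡ ∑ xs f * c
∑-*ʳ xs {f} c = trans (∑-cong xs (λ {x} _ → *-comm (f x) c))
  (trans (∑-*ˡ c xs) (*-comm c (∑ xs f)))

∑-+ : ∀ (xs : List A) f g → ∑ xs (λ x → f x + g x) ≡ ∑ xs f + ∑ xs g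
∑-+ []       f g = refl
∑-+ (x ∷ xs) f g = trans (cong (f x + g x +_) (∑-+ xs f g))
  (solve 4 (λ a b c d → (a :+ b) :+ (c :+ d) := (a :+ c) :+ (b :+ d)) refl
    (f x) (g x) (∑ xs f) (∑ xs g))

∑-swap : ∀ (xs : List A) (ys : List B) (f : A → B → ℚ) →
         ∑ xs (λ x → ∑ ys (f x)) ≡ ∑ ys (λ y → ∑ xs (λ x → f x y))
∑-swap []       ys f = sym (∑-0 ys)
∑-swap (x ∷ xs) ys f = trans (cong (∑ ys (f x) +_) (∑-swap xs ys f))
  (sym (∑-+ ys (f x) (λ y → ∑ xs (λ x → f x y))))

∑-++ : ∀ (xs ys : List A) f → ∑ (xs ++ ys) f ≡ ∑ xs f + ∑ ys f
∑-++ []       ys f = sym (+-identityˡ _)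
∑-++ (x ∷ xs) ys f = trans (cong (f x +_) (∑-++ xs ys f)) (sym (+-assoc (f x) _ _))

∑-map : ∀ (xs : List A) (g : A → B) f → ∑ (map g xs) f ≡ ∑ xs (f ∘ g)
∑-map []       g f = refl
∑-map (x ∷ xs) g f = cong (f (g x) +_) (∑-map xs g f)

-- The sum of f i over i < n.

∑< : ℕ → (ℕ → ℚ) → ℚ
∑< n = ∑ (downFrom n)

-- By definition ∑< splits off the last term; this splits off the first.

∑<-first : ∀ n f → ∑< (suc n) f ≡ f 0 + ∑< n (f ∘ suc)
∑<-first zero    f = refl
∑<-first (suc n) f = trans (cong (f (suc n) +_) (∑<-first n f))
  (solve 3 (λ a b c → a :+ (b :+ c) := b :+ (a :+ c)) refl
    (f (suc n)) (f 0) (∑< n (f ∘ suc)))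

------------------------------------------------------------------------
-- Rational arithmetic

/-distrib-+ : ∀ i j n .{{_ : ℕ.NonZero n}} → (i ℤ.+ j) / n ≡ i / n + j / n
/-distrib-+ i j n@(suc _) = toℚᵘ-injective (begin
  toℚᵘ ((i ℤ.+ j) / n)                ≈⟨ toℚᵘ-fromℚᵘ ((i ℤ.+ j) ℚᵘ./ n) ⟩
  (i ℤ.+ j) ℚᵘ./ n                    ≈⟨ ℚᵘ.*≡* (cross i j (ℤ.+ n)) ⟩
  i ℚᵘ./ n ℚᵘ.+ j ℚᵘ./ n              ≈⟨ ℚᵘ.+-cong (toℚᵘ-fromℚᵘ (i ℚᵘ./ n)) (toℚᵘ-fromℚᵘ (j ℚᵘ./ n)) ⟨
  toℚᵘ (i / n) ℚᵘ.+ toℚᵘ (j / n)      ≈⟨ toℚᵘ-homo-+ (i / n) (j / n) ⟨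
  toℚᵘ (i / n + j / n)                ∎)
  where
  open ℚᵘ.≃-Reasoning
  cross : ∀ i j d → (i ℤ.+ j) ℤ.* (d ℤ.* d) ≡ (i ℤ.* d ℤ.+ j ℤ.* d) ℤ.* d
  cross i j d = trans (sym (ℤ.*-assoc (i ℤ.+ j) d d)) (cong (ℤ._* d) (ℤ.*-distribʳ-+ d i j))

n/n≡1 : ∀ n .{{_ : ℕ.NonZero n}} → ℤ.+ n / n ≡ 1ℚ
n/n≡1 n@(suc _) = fromℚᵘ-cong {ℤ.+ n ℚᵘ./ n} {ℚᵘ.1ℚᵘ} (ℚᵘ.*≡* (ℤ.*-comm (ℤ.+ n) (ℤ.+ 1)))

fromℕ : ℕ → ℚ
fromℕ n = ℤ.+ n / 1

archimedean : ∀ p ε → 0ℚ < ε → ∃[ n ] p ≤ fromℕ n * ε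
archimedean p@(mkℚ i d-1 _) ε@(mkℚ j e-1 _) 0<ε = n , toℚᵘ-cancel-≤
  (ℚᵘ.≤-respʳ-≃ (ℚᵘ.≃-sym n*ε) (ℚᵘ.*≤* (cross j (positive 0<ε))))
  where
  -- With e the denominator of ε, 1 / e ≤ ε and p ≤ |i|, so |i| e steps of
  -- length ε suffice.
  n = ℤ.∣ i ∣ ℕ.* suc e-1

  n*ε : toℚᵘ (fromℕ n * ε) ℚᵘ.≃ ℤ.+ n ℚᵘ./ 1 ℚᵘ.* toℚᵘ ε
  n*ε = ℚᵘ.≃-trans (toℚᵘ-homo-* (fromℕ n) ε)
    (ℚᵘ.*-cong (toℚᵘ-fromℚᵘ (ℤ.+ n ℚᵘ./ 1)) ℚᵘ.≃-refl)

  i≤∣i∣ : ∀ i → i ℤ.≤ ℤ.+ ℤ.∣ i ∣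
  i≤∣i∣ (ℤ.+ _)    = ℤ.≤-refl
  i≤∣i∣ ℤ.-[1+ _ ] = ℤ.-≤+

  cross : ∀ j → ℤ.Positive j →
          i ℤ.* (ℤ.+ 1 ℤ.* ℤ.+ suc e-1) ℤ.≤ (ℤ.+ n ℤ.* j) ℤ.* ℤ.+ suc d-1
  cross ℤ.+[1+ m ] _ = begin
    i ℤ.* (ℤ.+ 1 ℤ.* ℤ.+ suc e-1)           ≡⟨ cong (i ℤ.*_) (ℤ.*-identityˡ (ℤ.+ suc e-1)) ⟩
    i ℤ.* ℤ.+ suc e-1                       ≤⟨ ℤ.*-monoʳ-≤-nonNeg (ℤ.+ suc e-1) (i≤∣i∣ i) ⟩
    ℤ.+ ℤ.∣ i ∣ ℤ.* ℤ.+ suc e-1             ≡⟨ ℤ.pos-* ℤ.∣ i ∣ (suc e-1) ⟨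
    ℤ.+ n                                   ≤⟨ ℤ.+≤+ (ℕ.m≤m*n n (suc m ℕ.* suc d-1)) ⟩
    ℤ.+ (n ℕ.* (suc m ℕ.* suc d-1))         ≡⟨ cong ℤ.+_ (ℕ.*-assoc n (suc m) (suc d-1)) ⟨
    ℤ.+ (n ℕ.* suc m ℕ.* suc d-1)           ≡⟨ ℤ.pos-* (n ℕ.* suc m) (suc d-1) ⟩
    ℤ.+ (n ℕ.* suc m) ℤ.* ℤ.+ suc d-1       ≡⟨ cong (ℤ._* ℤ.+ suc d-1) (ℤ.pos-* n (suc m)) ⟩
    (ℤ.+ n ℤ.* ℤ.+ suc m) ℤ.* ℤ.+ suc d-1   ∎
    where open ℤ.≤-Reasoning

------------------------------------------------------------------------
-- Order and addition in [0,∞]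

0≤∞ : ∀ x → 0∞ ≤∞ x
0≤∞ x = negative x

down≤ : ∀ x {p q} → p ≤ q → below x q → below x p
down≤ x p≤q q<x = let r , q<r , r<x = open′ x q<x in down x (≤-<-trans p≤q q<r) r<x

+∞-mono : x ≤∞ x′ → y ≤∞ y′ → x +∞ y ≤∞ x′ +∞ y′
+∞-mono x≤x′ y≤y′ (r , s , r<x , s<y , q≡) = r , s , x≤x′ r<x , y≤y′ s<y , q≡

+∞-comm : ∀ x y → x +∞ y ≤∞ y +∞ x
+∞-comm x y (r , s , r<x , s<y , q≡) = s , r , s<y , r<x , trans q≡ (+-comm r s)

+∞-assoc : ∀ x y z → (x +∞ y) +∞ z ≤∞ x +∞ (y +∞ z)
+∞-assoc x y z (_ , t , (r , s , r<x , s<y , refl) , t<z , q≡) =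
  r , s + t , r<x , (s , t , s<y , t<z , refl) , trans q≡ (+-assoc r s t)

0+x≤x : ∀ x → 0∞ +∞ x ≤∞ x
0+x≤x x (r , s , r<0 , s<x , refl) =
  down x (subst (r + s <_) (+-identityˡ s) (+-monoˡ-< s r<0)) s<x

x+0≤x : ∀ x → x +∞ 0∞ ≤∞ x
x+0≤x x = 0+x≤x x ∘ +∞-comm x 0∞

x≤x+y : ∀ x y → x ≤∞ x +∞ y
x≤x+y x y {q} q<x =
  let r , q<r , r<x = open′ x q<x in
  r , q - r
  , r<x
  , negative y (subst (q - r <_) (+-inverseʳ r) (+-monoˡ-< (- r) q<r))
  , solve 2 (λ q r → q := r :+ (q :- r)) refl q r

partialSum-mono : ∀ {u v} → (∀ n → u n ≤∞ v n) → ∀ n → partialSum u n ≤∞ partialSum v n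
partialSum-mono u≤v zero    q<0 = q<0
partialSum-mono {u} {v} u≤v (suc n) =
  +∞-mono {partialSum u n} {partialSum v n} {u n} {v n} (partialSum-mono u≤v n) (u≤v n)

-- If the terms of a series are rational, then so are its partial sums.

partialSum-ℚ : ∀ {u f} → (∀ n → below (u n) U.≐ (_< f n)) →
               ∀ n → below (partialSum u n) U.≐ (_< ∑< n f)
partialSum-ℚ u≐f zero = (λ q<0 → q<0) , (λ q<0 → q<0)
partialSum-ℚ {u} {f} u≐f (suc n) = to , from
  where
  to : ∀ {q} → below (partialSum u (suc n)) q → q < ∑< (suc n) f
  to (r , s , r<u , s<u , refl) =
    subst (r + s <_) (+-comm (∑< n f) (f n))
      (+-mono-< (proj₁ (partialSum-ℚ u≐f n) r<u) (proj₁ (u≐f n) s<u))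

  from : ∀ {q} → q < ∑< (suc n) f → below (partialSum u (suc n)) q
  from {q} q<∑ =
    -- Both cuts are strict, so the slack between q and the sum is shared.
    let m , q<m , m<∑ = <-dense q<∑ in
    m - f n , q - (m - f n)
    , proj₂ (partialSum-ℚ u≐f n)
        (subst (m - f n <_) (solve 2 (λ a b → (a :+ b) :- a := b) refl (f n) (∑< n f))
          (+-monoˡ-< (- f n) m<∑))
    , proj₂ (u≐f n)
        (subst (q - (m - f n) <_) (solve 2 (λ m a → m :- (m :- a) := a) refl m (f n))
          (+-monoˡ-< (- (m - f n)) q<m))
    , solve 2 (λ q r → q := r :+ (q :- r)) refl q (m - f n)

-- Only one inclusion of cuts survives when the fₙ are mere lower bounds.

below-partialSum : ∀ {u f} → (∀ n → below (u n) (f n)) →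
                   ∀ n {q} → q < ∑< n f → below (partialSum u n) q
below-partialSum f<u zero    q<0 = q<0
below-partialSum {u} {f} f<u (suc n) {q} q<∑ =
  q - f n , f n
  , below-partialSum f<u n
      (subst (q - f n <_) (solve 2 (λ a b → (a :+ b) :- a := b) refl (f n) (∑< n f))
        (+-monoˡ-< (- f n) q<∑))
  , f<u n
  , solve 2 (λ q r → q := (q :- r) :+ r) refl q (f n)

-- A finite element of [0,∞] can be approximated by rational numbers: on a
-- grid of width ε there is a first point that is not below x.

approximate : ExcludedMiddle 0ℓ → ∀ x {u ε} → ¬ below x u → 0ℚ < ε →
              ∃[ r ] below x (r - ε) × ¬ below x r
approximate em x {u} {ε} u≮x 0<ε = search K gridK≮x
  where
  -- Point 0 is negative, hence below x, and point K is at least u.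
  grid : ℕ → ℚ
  grid k = fromℕ k * ε - ε

  K = proj₁ (archimedean (u + ε) ε 0<ε)

  gridK≮x : ¬ below x (grid K)
  gridK≮x gridK<x = u≮x (down≤ x u≤gridK gridK<x)
    where
    u≤gridK : u ≤ grid K
    u≤gridK = subst (_≤ grid K) (solve 2 (λ u ε → (u :+ ε) :- ε := u) refl u ε)
      (+-monoˡ-≤ (- ε) (proj₂ (archimedean (u + ε) ε 0<ε)))

  grid-suc : ∀ k → grid (suc k) - ε ≡ grid k
  grid-suc k = trans
    (cong (λ n → n * ε - ε - ε) (/-distrib-+ (ℤ.+ 1) (ℤ.+ k) 1))
    (solve 2 (λ n ε → (con 1ℚ :+ n) :* ε :- ε :- ε := n :* ε :- ε) refl (fromℕ k) ε)

  search : ∀ k → ¬ below x (grid k) → ∃[ r ] below x (r - ε) × ¬ below x r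
  search zero    g≮x = contradiction
    (negative x (subst (_< 0ℚ) (sym (trans (cong (_- ε) (*-zeroˡ ε)) (+-identityˡ (- ε))))
      (neg-antimono-< 0<ε))) g≮x
  search (suc k) g≮x with em {below x (grid k)}
  ... | yes g<x = grid (suc k) , subst (below x) (sym (grid-suc k)) g<x , g≮x
  ... | no  g≮x = search k g≮x

------------------------------------------------------------------------
-- Carathéodory's theorem

-- The hypotheses say that μ is an outer measure.

module Carathéodory
  (em : ExcludedMiddle 0ℓ) {X : Setoid 0ℓ 0ℓ} (μ : Subset X → [0,∞])
  (μ-mono : ∀ {A B} → A ⊆ B → μ A ≤∞ μ B)
  (μ-∅ : μ ∅ ≤∞ 0∞)
  (μ-subadditive : ∀ A → μ (⋃ A) ≤∞ Σ∞ (μ ∘ A))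
  where

  -- Carathéodory's criterion.

  IsMeasurable : Subset X → Set₁
  IsMeasurable A = ∀ S → μ S ≃ μ (S ∩ A) +∞ μ (S ∩ ∁ A)

  private variable
    E F : Subset X

  -- The sequence A, B, ∅, ∅, …, which makes binary subadditivity a case of
  -- countable subadditivity.

  pair : Subset X → Subset X → ℕ → Subset X
  pair A B zero          = A
  pair A B (suc zero)    = B
  pair A B (suc (suc _)) = ∅

  μ-subadditive₂ : ∀ A B → E ⊆ ⋃ (pair A B) → μ E ≤∞ μ A +∞ μ B
  μ-subadditive₂ A B E⊆ q<E =
    let n , q<s = μ-subadditive (pair A B) (μ-mono E⊆ q<E) in bound n q<s
    where
    bound : ∀ n → partialSum (μ ∘ pair A B) n ≤∞ μ A +∞ μ B
    bound zero                = 0≤∞ (μ A +∞ μ B)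
    bound (suc zero)          = x≤x+y (μ A) (μ B) ∘ 0+x≤x (μ A)
    bound (suc (suc zero))    = +∞-mono {0∞ +∞ μ A} {μ A} {μ B} {μ B} (0+x≤x (μ A)) id
    bound (suc (suc (suc n))) = x+0≤x (μ A +∞ μ B) ∘
      +∞-mono {partialSum (μ ∘ pair A B) (suc (suc n))} {μ A +∞ μ B} {μ ∅} {0∞}
        (bound (suc (suc n))) μ-∅

  -- The other inequality of the criterion is subadditivity.

  measurable : ∀ A → (∀ S → μ (S ∩ A) +∞ μ (S ∩ ∁ A) ≤∞ μ S) → IsMeasurable A
  measurable A split S = μ-subadditive₂ (S ∩ A) (S ∩ ∁ A) cases , split S
    where
    cases : S ⊆ ⋃ (pair (S ∩ A) (S ∩ ∁ A))
    cases {x} s with em {A ∋ x}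
    ... | yes a = 0 , s , a
    ... | no ¬a = 1 , s , ¬a

  meas-resp-≐ : E ≐ F → IsMeasurable E → IsMeasurable F
  meas-resp-≐ {A} {B} (A⊆B , B⊆A) mA = measurable B λ S →
    proj₂ (mA S) ∘ +∞-mono {μ (S ∩ B)} {μ (S ∩ A)} {μ (S ∩ ∁ B)} {μ (S ∩ ∁ A)}
      (μ-mono (map₂ B⊆A)) (μ-mono (map₂ λ ¬b a → ¬b (A⊆B a)))

  meas-full : IsMeasurable full
  meas-full = measurable full λ S →
    x+0≤x (μ S) ∘ +∞-mono {μ (S ∩ full)} {μ S} {μ (S ∩ ∁ full)} {0∞}
      (μ-mono proj₁) (μ-∅ ∘ μ-mono λ (_ , ¬u) → ¬u _)

  meas-∁ : IsMeasurable E → IsMeasurable (∁ E)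
  meas-∁ {A} mA = measurable (∁ A) λ S →
    proj₂ (mA S) ∘ +∞-comm (μ (S ∩ ∁ A)) (μ (S ∩ A)) ∘
    +∞-mono {μ (S ∩ ∁ A)} {μ (S ∩ ∁ A)} {μ (S ∩ ∁ (∁ A))} {μ (S ∩ A)}
      id (μ-mono (map₂ (decidable-stable em)))

  -- What the first n sets of a sequence leave of S.

  rest : Subset X → (ℕ → Subset X) → ℕ → Subset X
  rest S A zero    = S
  rest S A (suc n) = rest S A n ∩ ∁ (A n)

  -- What the n-th set takes from S: the points of S whose first set is A n.

  piece : Subset X → (ℕ → Subset X) → ℕ → Subset X
  piece S A n = rest S A n ∩ A n

  pieces+rest≤ : ∀ S A → (∀ n → IsMeasurable (A n)) →
                 ∀ n → partialSum (μ ∘ piece S A) n +∞ μ (rest S A n) ≤∞ μ S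
  pieces+rest≤ S A mA zero    = 0+x≤x (μ S)
  pieces+rest≤ S A mA (suc n) =
    pieces+rest≤ S A mA n ∘
    +∞-mono {Σn} {Σn} {μ (piece S A n) +∞ μ (rest S A (suc n))} {μ (rest S A n)}
      id (proj₂ (mA n (rest S A n))) ∘
    +∞-assoc Σn (μ (piece S A n)) (μ (rest S A (suc n)))
    where Σn = partialSum (μ ∘ piece S A) n

  ∁⋃⊆rest : ∀ S A n → S ∩ ∁ (⋃ A) ⊆ rest S A n
  ∁⋃⊆rest S A zero    (s , _)  = s
  ∁⋃⊆rest S A (suc n) (s , ¬a) = ∁⋃⊆rest S A n (s , ¬a) , λ a → ¬a (n , a)

  rest-or-piece : ∀ S A n {x} → S ∋ x → rest S A n ∋ x ⊎ ⋃ (piece S A) ∋ x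
  rest-or-piece S A zero    s = inj₁ s
  rest-or-piece S A (suc n) {x} s with rest-or-piece S A n s | em {A n ∋ x}
  ... | inj₂ p | _     = inj₂ p
  ... | inj₁ r | yes a = inj₂ (n , r , a)
  ... | inj₁ r | no ¬a = inj₁ (r , ¬a)

  ∩⋃⊆pieces : ∀ S A → S ∩ ⋃ A ⊆ ⋃ (piece S A)
  ∩⋃⊆pieces S A (s , n , a) with rest-or-piece S A n s
  ... | inj₁ r = n , r , a
  ... | inj₂ p = p

  meas-⋃ : ∀ {A : ℕ → Subset X} → (∀ n → IsMeasurable (A n)) → IsMeasurable (⋃ A)
  meas-⋃ {A} mA = measurable (⋃ A) split
    where
    split : ∀ S → μ (S ∩ ⋃ A) +∞ μ (S ∩ ∁ (⋃ A)) ≤∞ μ S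
    split S (r , s , r<⋃ , s<∁ , q≡) =
      let n , r<Σ = μ-subadditive (piece S A) (μ-mono (∩⋃⊆pieces S A) r<⋃)
      in pieces+rest≤ S A mA n (r , s , r<Σ , μ-mono (∁⋃⊆rest S A n) s<∁ , q≡)

  -- For disjoint sets the pieces of the union are the sets themselves.

  disjoint⊆piece : ∀ A → (∀ {m n} → m ≢ n → Disjoint (A m) (A n)) →
                   ∀ n → A n ⊆ piece (⋃ A) A n
  disjoint⊆piece A disj n {x} a = in-rest n ℕ.≤-refl , a
    where
    in-rest : ∀ m → m ℕ.≤ n → rest (⋃ A) A m ∋ x
    in-rest zero    _   = n , a
    in-rest (suc m) m<n = in-rest m (ℕ.<⇒≤ m<n) , disj (ℕ.>⇒≢ m<n) a

  μ-σ-additive : ∀ {A : ℕ → Subset X} → (∀ n → IsMeasurable (A n)) →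
                 (∀ {m n} → m ≢ n → Disjoint (A m) (A n)) →
                 μ (⋃ A) ≃ Σ∞ (μ ∘ A)
  μ-σ-additive {A} mA disj = μ-subadditive A , λ (n , q<Σ) →
    pieces+rest≤ (⋃ A) A mA n
      (x≤x+y (partialSum (μ ∘ piece (⋃ A) A) n) (μ (rest (⋃ A) A n))
        (partialSum-mono {μ ∘ A} {μ ∘ piece (⋃ A) A}
          (λ i → μ-mono (disjoint⊆piece A disj i)) n q<Σ))

------------------------------------------------------------------------
-- Enumeration of a double sequence

-- The lists xs, L 0, L 1, … one after the other. Each is followed by one
-- copy of the default d, which makes the recursion on the index structural
-- even where lists are empty.

concat : A → List A → (ℕ → List A) → ℕ → A
concat d []       L zero    = d
concat d []       L (suc k) = concat d (L 0) (L ∘ suc) k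
concat d (x ∷ xs) L zero    = x
concat d (x ∷ xs) L (suc k) = concat d xs L k

∈-concat : ∀ (d : A) xs L {x} → x ∈ xs → ∃[ k ] concat d xs L k ≡ x
∈-concat d (x ∷ xs) L (here refl)  = 0 , refl
∈-concat d (x ∷ xs) L (there x∈xs) =
  let k , eq = ∈-concat d xs L x∈xs in suc k , eq

∈-concat-later : ∀ (d : A) xs L n {x} → x ∈ L n → ∃[ k ] concat d xs L k ≡ x
∈-concat-later d (_ ∷ xs) L n x∈Ln =
  let k , eq = ∈-concat-later d xs L n x∈Ln in suc k , eq
∈-concat-later d [] L zero x∈L0 =
  let k , eq = ∈-concat d (L 0) (L ∘ suc) x∈L0 in suc k , eq
∈-concat-later d [] L (suc n) x∈Ln =
  let k , eq = ∈-concat-later d (L 0) (L ∘ suc) n x∈Ln in suc k , eq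

-- The first K entries come from xs, L 0, …, L (K - 1) and the default. The
-- default has weight 0 and no weight is negative.

∑-concat : ∀ (d : A) {v} → v d ≡ 0ℚ → (∀ x → 0ℚ ≤ v x) → ∀ K xs L →
           ∑< K (v ∘ concat d xs L) ≤ ∑ xs v + ∑< K (λ n → ∑ (L n) v)
∑-concat d {v} vd≡0 0≤v zero xs L =
  subst (0ℚ ≤_) (sym (+-identityʳ (∑ xs v))) (∑-nonNeg xs 0≤v)
∑-concat d {v} vd≡0 0≤v (suc K) [] L = begin
  ∑< (suc K) (v ∘ concat d [] L)                        ≡⟨ ∑<-first K (v ∘ concat d [] L) ⟩
  v d + ∑< K (v ∘ concat d (L 0) (L ∘ suc))             ≡⟨ cong (_+ ∑< K (v ∘ concat d (L 0) (L ∘ suc))) vd≡0 ⟩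
  0ℚ + ∑< K (v ∘ concat d (L 0) (L ∘ suc))              ≤⟨ +-monoʳ-≤ 0ℚ (∑-concat d vd≡0 0≤v K (L 0) (L ∘ suc)) ⟩
  0ℚ + (∑ (L 0) v + ∑< K (λ n → ∑ (L (suc n)) v))       ≡⟨ cong (0ℚ +_) (∑<-first K (λ n → ∑ (L n) v)) ⟨
  0ℚ + ∑< (suc K) (λ n → ∑ (L n) v)                     ∎
  where open ≤-Reasoning
∑-concat d {v} vd≡0 0≤v (suc K) (x ∷ xs) L = begin
  ∑< (suc K) (v ∘ concat d (x ∷ xs) L)                  ≡⟨ ∑<-first K (v ∘ concat d (x ∷ xs) L) ⟩
  v x + ∑< K (v ∘ concat d xs L)                        ≤⟨ +-monoʳ-≤ (v x) (∑-concat d vd≡0 0≤v K xs L) ⟩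
  v x + (∑ xs v + ∑< K (λ n → ∑ (L n) v))               ≡⟨ +-assoc (v x) (∑ xs v) _ ⟨
  ∑ (x ∷ xs) v + ∑< K (λ n → ∑ (L n) v)                 ≤⟨ +-monoʳ-≤ (∑ (x ∷ xs) v) less ⟩
  ∑ (x ∷ xs) v + ∑< (suc K) (λ n → ∑ (L n) v)           ∎
  where
  open ≤-Reasoning
  less : ∑< K (λ n → ∑ (L n) v) ≤ ∑< (suc K) (λ n → ∑ (L n) v)
  less = subst (_≤ ∑< (suc K) (λ n → ∑ (L n) v)) (+-identityˡ (∑< K (λ n → ∑ (L n) v)))
    (+-monoˡ-≤ (∑< K (λ n → ∑ (L n) v)) (∑-nonNeg (L K) 0≤v))

-- The entries C i j with i ⊔ j = n.

shell : (ℕ → ℕ → A) → ℕ → List A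
shell C n = map (C n) (downFrom (suc n)) ++ map (λ i → C i n) (downFrom n)

∈-shell : ∀ (C : ℕ → ℕ → A) i j → ∃[ n ] C i j ∈ shell C n
∈-shell C i j with ℕ.≤-<-connex j i
... | inj₁ j≤i = i , ∈-++⁺ˡ (∈-map⁺ (C i) (∈-downFrom⁺ (ℕ.s≤s j≤i)))
... | inj₂ i<j = j , ∈-++⁺ʳ (map (C j) (downFrom (suc j)))
  (∈-map⁺ (λ i → C i j) (∈-downFrom⁺ i<j))

-- The first K shells make up the square of side K.

∑-shells : ∀ (C : ℕ → ℕ → A) v K →
           ∑< K (λ n → ∑ (shell C n) v) ≡ ∑< K (λ i → ∑< K (v ∘ C i))
∑-shells C v zero    = refl
∑-shells C v (suc K) = begin
  ∑ (shell C K) v + ∑< K (λ n → ∑ (shell C n) v)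
    ≡⟨ cong₂ _+_ shellK (∑-shells C v K) ⟩
  (row + column) + square
    ≡⟨ +-assoc row column square ⟩
  row + (column + square)
    ≡⟨ cong (row +_) (∑-+ (downFrom K) (λ i → v (C i K)) (λ i → ∑< K (v ∘ C i))) ⟨
  row + ∑< K (λ i → ∑< (suc K) (v ∘ C i))
    ∎
  where
  open ≡-Reasoning
  row    = ∑< (suc K) (v ∘ C K)
  column = ∑< K (λ i → v (C i K))
  square = ∑< K (λ i → ∑< K (v ∘ C i))

  shellK : ∑ (shell C K) v ≡ row + column
  shellK = trans (∑-++ (map (C K) (downFrom (suc K))) _ v)
    (cong₂ _+_ (∑-map (downFrom (suc K)) (C K) v) (∑-map (downFrom K) (λ i → C i K) v))

-- An enumeration of the double sequence C, shell by shell.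

merge : A → (ℕ → ℕ → A) → ℕ → A
merge d C = concat d [] (shell C)

∈-merge : ∀ d (C : ℕ → ℕ → A) i j → ∃[ k ] merge d C k ≡ C i j
∈-merge d C i j = let n , c∈ = ∈-shell C i j in ∈-concat-later d [] (shell C) n c∈

∑-merge : ∀ (d : A) {v} → v d ≡ 0ℚ → (∀ x → 0ℚ ≤ v x) → ∀ C K →
          ∑< K (v ∘ merge d C) ≤ ∑< K (λ i → ∑< K (v ∘ C i))
∑-merge d {v} vd≡0 0≤v C K = ≤-trans (∑-concat d vd≡0 0≤v K [] (shell C))
  (≤-reflexive (trans (+-identityˡ _) (∑-shells C v K)))

------------------------------------------------------------------------
-- Halving

-- The sequence δ/2, δ/4, δ/8, …, with sum δ.

halves : ℚ → ℕ → ℚ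
halves δ zero    = ½ * δ
halves δ (suc n) = ½ * halves δ n

halves-pos : ∀ {δ} → 0ℚ < δ → ∀ n → 0ℚ < halves δ n
halves-pos {δ} 0<δ zero    = subst (_< ½ * δ) (*-zeroʳ ½) (*-monoʳ-<-pos ½ 0<δ)
halves-pos {δ} 0<δ (suc n) =
  subst (_< ½ * halves δ n) (*-zeroʳ ½) (*-monoʳ-<-pos ½ (halves-pos 0<δ n))

½+½ : ∀ p → ½ * p + ½ * p ≡ p
½+½ = solve 1 (λ p → con ½ :* p :+ con ½ :* p := p) refl

∑-halves : ∀ δ n → ∑< (suc n) (halves δ) + halves δ n ≡ δ
∑-halves δ zero    = trans (cong (_+ ½ * δ) (+-identityʳ (½ * δ))) (½+½ δ)
∑-halves δ (suc n) = trans
  (solve 2 (λ h s → (con ½ :* h :+ s) :+ con ½ :* h := s :+ h) refl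
    (halves δ n) (∑< (suc n) (halves δ)))
  (∑-halves δ n)

∑-halves≤ : ∀ {δ} → 0ℚ < δ → ∀ n → ∑< n (halves δ) ≤ δ
∑-halves≤ 0<δ zero    = <⇒≤ 0<δ
∑-halves≤ {δ} 0<δ (suc n) = subst (∑< (suc n) (halves δ) ≤_) (∑-halves δ n)
  (subst (_≤ ∑< (suc n) (halves δ) + halves δ n) (+-identityʳ (∑< (suc n) (halves δ)))
    (+-monoʳ-≤ (∑< (suc n) (halves δ)) (<⇒≤ (halves-pos 0<δ n))))

------------------------------------------------------------------------
-- Countable subadditivity of P

module OuterMeasure (em : ExcludedMiddle 0ℓ) (Λ : Set) (w : Λ → Λ → ℕ)
                    (finite : ∀ a → IsFinite (λ b → w a b ≢ 0)) where
  open Strategies Λ w finite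

  -- The rational probability of a box, and 0 where a family has no box.

  mass : Maybe Box → ℚ
  mass = maybe′ (product ∘ constraints) 0ℚ

  mass-nonNeg : ∀ b → 0ℚ ≤ mass b
  mass-nonNeg nothing  = ≤-refl
  mass-nonNeg (just B) =
    nonNegative⁻¹ (product (constraints B)) {{product-nonNeg (constraints B)}}

  p-≐ : ∀ b → below (maybe′ p 0∞ b) U.≐ (_< mass b)
  p-≐ nothing  = id , id
  p-≐ (just B) = id , id

  total-≐ : ∀ C → below (total C) U.≐ λ q → ∃[ n ] q < ∑< n (mass ∘ C)
  total-≐ C = (λ (n , q<s) → n , proj₁ (sums n) q<s) , (λ (n , q<s) → n , proj₂ (sums n) q<s)
    where sums = partialSum-ℚ {λ n → maybe′ p 0∞ (C n)} {mass ∘ C} (p-≐ ∘ C)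

  P-mono : ∀ {S T} → S ⊆ T → P S ≤∞ P T
  P-mono S⊆T (q′ , q<q′ , q′<T) = q′ , q<q′ , λ (C , cov) → q′<T (C , cov ∘ S⊆T)

  P-full≤1 : P full ≤∞ 1∞
  P-full≤1 (q′ , q<q′ , q′<totals) =
    let n , q′<∑ = proj₁ (total-≐ C) (q′<totals (C , λ _ → 0 , everything , refl , []))
    in <-trans q<q′ (<-≤-trans q′<∑ (∑≤1 n))
    where
    -- The box without constraints contains every strategy and has mass 1.
    everything : Box
    everything = record { constraints = [] ; distinct = [] }

    C : Family
    C zero    = just everything
    C (suc _) = nothing

    ∑≤1 : ∀ n → ∑< n (mass ∘ C) ≤ 1ℚ
    ∑≤1 zero    = nonNegative⁻¹ 1ℚ
    ∑≤1 (suc n) = ≤-reflexive (trans (∑<-first n (mass ∘ C)) (cong (1ℚ +_) (∑-0 (downFrom n))))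

  -- The infimum P S is approached by the totals of covers.

  near-cover : ∀ S {r} → ¬ below (P S) r → ∀ {r′} → r < r′ →
               Σ[ C ∈ Family ] Covers C S × (∀ n → ∑< n (mass ∘ C) ≤ r′)
  near-cover S {r} r≮P {r′} r<r′ with em {Σ[ C ∈ Family ] Covers C S × ¬ below (total C) r′}
  ... | yes (C , cov , r′≮C) = C , cov , λ n → ≮⇒≥ λ r′<∑ → r′≮C (proj₂ (total-≐ C) (n , r′<∑))
  ... | no  none = contradiction
    (r′ , r<r′ , λ (C , cov) → decidable-stable em λ r′≮C → none (C , cov , r′≮C)) r≮P

  -- Suppose that q′ > q is below the totals of all covers of ⋃ A, and that no
  -- partial sum of the P (A n) exceeds q. The slack δ = q′ - q, distributed
  -- over near-optimal covers of the A n, leaves a merged cover D with total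
  -- at most q′, which is absurd.

  P-subadditive : ∀ A → P (⋃ A) ≤∞ Σ∞ (P ∘ A)
  P-subadditive A {q} (q′ , q<q′ , q′<totals) with em {∃[ n ] below (partialSum (P ∘ A) n) q}
  ... | yes q<Σ = q<Σ
  ... | no  q≮Σ = contradiction (<-≤-trans (proj₂ q′<D) (∑D≤q′ (proj₁ q′<D))) (<-irrefl refl)
    where
    δ = q′ - q

    0<δ : 0ℚ < δ
    0<δ = subst (_< δ) (+-inverseʳ q) (+-monoˡ-< (- q) q<q′)

    ε = halves δ

    -- A cover of A n with total at most r, where r is less than P (A n) + ε n.

    record Approximation (n : ℕ) : Set where
      field
        r      : ℚ
        r<P    : below (P (A n)) (r - ε n)
        cover  : Family
        covers : Covers cover (A n)
        mass≤r : ∀ m → ∑< m (mass ∘ cover) ≤ r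

    approximation : ∀ n → Approximation n
    approximation n = record
      { r = r + ½ * ε n
      ; r<P = subst (below (P (A n)))
          (solve 2 (λ r e → r :- con ½ :* e := r :+ con ½ :* e :- e) refl r (ε n)) r<P
      ; cover = proj₁ near ; covers = proj₁ (proj₂ near) ; mass≤r = proj₂ (proj₂ near) }
      where
      -- Half of ε n is spent on the rational approximation, half on the cover.
      ½ε = halves-pos 0<δ (suc n)
      approx = approximate em (P (A n)) {1ℚ} {½ * ε n}
        (λ 1<P → <-irrefl refl (P-full≤1 (P-mono {A n} {full} (λ _ → _) 1<P))) ½ε
      r = proj₁ approx
      r<P = proj₁ (proj₂ approx)
      near = near-cover (A n) (proj₂ (proj₂ approx))
        (subst (_< r + ½ * ε n) (+-identityʳ r) (+-monoʳ-< r ½ε))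

    open module Approx n = Approximation (approximation n)

    D : Family
    D = merge nothing cover

    D-covers : Covers D (⋃ A)
    D-covers (n , a) =
      let j , B , eq , f∈B = covers n a
          k , eq′ = ∈-merge nothing cover n j
      in k , B , trans eq′ eq , f∈B

    q′<D = proj₁ (total-≐ D) (q′<totals (D , D-covers))

    ∑r-ε≤q : ∀ n → ∑< n (λ i → r i - ε i) ≤ q
    ∑r-ε≤q n = ≮⇒≥ λ q<∑ → q≮Σ (n , below-partialSum r<P n q<∑)

    ∑D≤q′ : ∀ n → ∑< n (mass ∘ D) ≤ q′
    ∑D≤q′ n = begin
      ∑< n (mass ∘ D)                              ≤⟨ ∑-merge nothing refl mass-nonNeg cover n ⟩
      ∑< n (λ i → ∑< n (mass ∘ cover i))           ≤⟨ ∑-mono (downFrom n) (λ {i} _ → mass≤r i n) ⟩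
      ∑< n r                                       ≡⟨ ∑-cong (downFrom n) (λ {i} _ →
        solve 2 (λ r e → r := (r :- e) :+ e) refl (r i) (ε i)) ⟩
      ∑< n (λ i → (r i - ε i) + ε i)               ≡⟨ ∑-+ (downFrom n) _ ε ⟩
      ∑< n (λ i → r i - ε i) + ∑< n ε              ≤⟨ +-mono-≤ (∑r-ε≤q n) (∑-halves≤ 0<δ n) ⟩
      q + δ                                        ≡⟨ solve 2 (λ q q′ → q :+ (q′ :- q) := q′) refl q q′ ⟩
      q′                                           ∎
      where open ≤-Reasoning

------------------------------------------------------------------------
-- Weighted means and indicators

0≤* : ∀ {p q} → 0ℚ ≤ p → 0ℚ ≤ q → 0ℚ ≤ p * q
0≤* {p} {q} 0≤p 0≤q =
  nonNegative⁻¹ (p * q) {{nonNeg*nonNeg⇒nonNeg p {{nonNegative 0≤p}} q {{nonNegative 0≤q}}}}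

-- A weighted mean of numbers greater than q is greater than q.

mean> : ∀ (xs : List A) {c v : A → ℚ} {q} → (∀ {x} → x ∈ xs → 0ℚ < c x) →
        (∀ {x} → x ∈ xs → q < v x) → ∑ xs c ≡ 1ℚ → q < ∑ xs (λ x → c x * v x)
mean> [] _ _ ()
mean> (x ∷ xs) {c} {v} {q} 0<c q<v ∑c≡1 = begin-strict
  q                                         ≡⟨ *-identityˡ q ⟨
  1ℚ * q                                    ≡⟨ cong (_* q) ∑c≡1 ⟨
  ∑ (x ∷ xs) c * q                          ≡⟨ ∑-*ʳ (x ∷ xs) {c} q ⟨
  c x * q + ∑ xs (λ y → c y * q)            <⟨ +-mono-<-≤
    (*-monoʳ-<-pos (c x) {{positive (0<c (here refl))}} (q<v (here refl)))
    (∑-mono xs {λ y → c y * q} {λ y → c y * v y} λ {y} y∈ → *-monoˡ-≤-nonNeg (c y) {{nonNegative (<⇒≤ (0<c (there y∈)))}}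
      (<⇒≤ (q<v (there y∈)))) ⟩
  ∑ (x ∷ xs) (λ x → c x * v x)              ∎
  where open ≤-Reasoning

-- Finitely many properties that hold eventually hold at a common index.

eventually-all : ∀ (xs : List A) {Q : A → ℕ → Set} →
                 (∀ {x} → x ∈ xs → ∃[ N ] (∀ n → N ℕ.≤ n → Q x n)) →
                 ∃[ N ] (∀ {x} → x ∈ xs → Q x N)
eventually-all xs {Q} ev = let N , q = go xs ev in N , λ x∈ → q x∈ N ℕ.≤-refl
  where
  go : ∀ xs → (∀ {x} → x ∈ xs → ∃[ N ] (∀ n → N ℕ.≤ n → Q x n)) →
       ∃[ N ] (∀ {x} → x ∈ xs → ∀ n → N ℕ.≤ n → Q x n)
  go []       _  = 0 , λ ()
  go (x ∷ xs) ev =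
    let M , qx = ev (here refl); N , qxs = go xs (ev ∘ there)
    in M ℕ.⊔ N , λ { (here refl) n le → qx n (ℕ.m⊔n≤o⇒m≤o M N le)
                   ; (there x∈)  n le → qxs x∈ n (ℕ.m⊔n≤o⇒n≤o M N le) }

∑<-mono-index : ∀ {f} → (∀ n → 0ℚ ≤ f n) → ∀ {m n} → m ℕ.≤′ n → ∑< m f ≤ ∑< n f
∑<-mono-index 0≤f ℕ.≤′-refl = ≤-refl
∑<-mono-index {f} 0≤f {m} (ℕ.≤′-step {n} m≤n) = ≤-trans (∑<-mono-index 0≤f m≤n)
  (subst (_≤ ∑< (suc n) f) (+-identityˡ (∑< n f)) (+-monoˡ-≤ (∑< n f) (0≤f n)))

-- The truth value of a decided proposition as a rational number.

indicator : Dec A → ℚ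
indicator (yes _) = 1ℚ
indicator (no  _) = 0ℚ

indicator-yes : ∀ (A? : Dec A) → A → indicator A? ≡ 1ℚ
indicator-yes (yes _) _ = refl
indicator-yes (no ¬a) a = contradiction a ¬a

indicator-no : ∀ (A? : Dec A) → ¬ A → indicator A? ≡ 0ℚ
indicator-no (yes a) ¬a = contradiction a ¬a
indicator-no (no _)  _  = refl

module _ (_≟_ : (x y : A) → Dec (x ≡ y)) (f : A → ℚ) where

  ∑-indicator-∉ : ∀ {k} xs → k ∉ xs → ∑ xs (λ x → f x * indicator (x ≟ k)) ≡ 0ℚ
  ∑-indicator-∉ {k} xs k∉ = trans
    (∑-cong xs λ {x} x∈ → trans
      (cong (f x *_) (indicator-no (x ≟ k) λ { refl → k∉ x∈ })) (*-zeroʳ (f x)))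
    (∑-0 xs)

  ∑-indicator : ∀ {k} xs → Unique xs → (k ∉ xs → f k ≡ 0ℚ) →
                ∑ xs (λ x → f x * indicator (x ≟ k)) ≡ f k
  ∑-indicator []       _        fk≡0 = sym (fk≡0 λ ())
  ∑-indicator {k} (x ∷ xs) (x∉ ∷ u) fk≡0 with x ≟ k
  ... | yes refl = trans
    (cong₂ _+_ (*-identityʳ (f x)) (∑-indicator-∉ xs λ x∈ → All.lookup x∉ x∈ refl))
    (+-identityʳ (f x))
  ... | no x≢k   = trans
    (cong₂ _+_ (*-zeroʳ (f x))
      (∑-indicator xs u λ k∉ → fk≡0 λ { (here refl) → x≢k refl ; (there k∈) → k∉ k∈ }))
    (+-identityˡ (f k))

------------------------------------------------------------------------
-- Conditional probabilities and total mass

module TotalMass (em : ExcludedMiddle 0ℓ) (Λ : Set) (w : Λ → Λ → ℕ)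
                 (finite : ∀ a → IsFinite (λ b → w a b ≢ 0)) where
  open Strategies Λ w finite
  open OuterMeasure em Λ w finite

  -- The possible successors of an object.

  support : Λ⁺ → List Λ
  support (a , _) = proj₁ (finite a)

  support⇒w≢0 : ∀ a {b} → b ∈ support a → w (proj₁ a) b ≢ 0
  support⇒w≢0 (a , _) {b} = Equivalence.to (proj₂ (proj₂ (finite a)) b)

  factor-nonNeg : ∀ a b → 0ℚ ≤ factor (a , b)
  factor-nonNeg a@(k , 1≤ρ) b =
    nonNegative⁻¹ (factor (a , b)) {{normalize-nonNeg (w k b) (ρ k) {{ℕ.>-nonZero 1≤ρ}}}}

  factor-pos : ∀ a {b} → b ∈ support a → 0ℚ < factor (a , b)
  factor-pos a@(k , 1≤ρ) {b} b∈ = positive⁻¹ (factor (a , b))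
    {{normalize-pos (w k b) (ρ k) {{ℕ.>-nonZero 1≤ρ}} {{ℕ.≢-nonZero (support⇒w≢0 a b∈)}}}}

  factor≡0 : ∀ a {b} → b ∉ support a → factor (a , b) ≡ 0ℚ
  factor≡0 (k , 1≤ρ) {b} b∉ with w k b ℕ.≟ 0
  ... | yes w≡0 = trans (cong (λ m → _/_ (ℤ.+ m) (ρ k) {{ℕ.>-nonZero 1≤ρ}}) w≡0)
                        (0/n≡0 (ρ k) {{ℕ.>-nonZero 1≤ρ}})
  ... | no  w≢0 = contradiction (Equivalence.from (proj₂ (proj₂ (finite k)) b) w≢0) b∉

  ∑-factor : ∀ a → ∑ (support a) (λ b → factor (a , b)) ≡ 1ℚ
  ∑-factor (k , 1≤ρ) = trans (∑-/ (support (k , 1≤ρ))) (n/n≡1 (ρ k))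
    where
    instance _ = ℕ.>-nonZero 1≤ρ
    ∑-/ : ∀ xs → ∑ xs (λ b → ℤ.+ w k b / ρ k) ≡ ℤ.+ sum (map (w k) xs) / ρ k
    ∑-/ []       = sym (0/n≡0 (ρ k))
    ∑-/ (b ∷ xs) = trans (cong (ℤ.+ w k b / ρ k +_) (∑-/ xs))
      (sym (/-distrib-+ (ℤ.+ w k b) (ℤ.+ sum (map (w k) xs)) (ρ k)))

  -- A partial choice of successors. That the chosen values are successors is
  -- a separate condition; see Stage.

  Assignment : Set
  Assignment = Λ⁺ → Maybe Λ

  unassigned : Assignment
  unassigned _ = nothing

  -- The conditional probability, given σ, that a is sent to a′; then of a
  -- list of constraints, and of a box. Given the empty assignment these are
  -- the unconditional factor, product and mass, by computation.

  factorAt : Assignment → Λ⁺ × Λ → ℚ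
  factorAt σ (a , a′) = maybe′ (λ b → indicator (em {b ≡ a′})) (factor (a , a′)) (σ a)

  productAt : Assignment → List (Λ⁺ × Λ) → ℚ
  productAt σ cs = foldr _*_ 1ℚ (map (factorAt σ) cs)

  massAt : Assignment → Maybe Box → ℚ
  massAt σ = maybe′ (productAt σ ∘ constraints) 0ℚ

  factorAt-nonNeg : ∀ σ c → 0ℚ ≤ factorAt σ c
  factorAt-nonNeg σ (a , a′) with σ a
  ... | nothing = factor-nonNeg a a′
  ... | just b with em {b ≡ a′}
  ...   | yes _ = nonNegative⁻¹ 1ℚ
  ...   | no  _ = ≤-refl

  productAt-nonNeg : ∀ σ cs → 0ℚ ≤ productAt σ cs
  productAt-nonNeg σ []       = nonNegative⁻¹ 1ℚ
  productAt-nonNeg σ (c ∷ cs) = 0≤* (factorAt-nonNeg σ c) (productAt-nonNeg σ cs)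

  massAt-nonNeg : ∀ σ b → 0ℚ ≤ massAt σ b
  massAt-nonNeg σ nothing  = ≤-refl
  massAt-nonNeg σ (just B) = productAt-nonNeg σ (constraints B)

  productAt-satisfied : ∀ σ {cs} → All (λ (a , a′) → σ a ≡ just a′) cs → productAt σ cs ≡ 1ℚ
  productAt-satisfied σ [] = refl
  productAt-satisfied σ {(a , a′) ∷ cs} (σa≡ ∷ sat) = cong₂ _*_
    (trans (cong (maybe′ (λ b → indicator (em {b ≡ a′})) (factor (a , a′))) σa≡)
      (indicator-yes em refl))
    (productAt-satisfied σ sat)

  -- σ with the value at a set to b.

  infixl 8 _[_↦_]

  _[_↦_] : Assignment → Λ⁺ → Λ → Assignment
  (σ [ a ↦ b ]) k with em {k ≡ a}
  ... | yes _ = just b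
  ... | no  _ = σ k

  update-here : ∀ σ a b → (σ [ a ↦ b ]) a ≡ just b
  update-here σ a b with em {a ≡ a}
  ... | yes _   = refl
  ... | no  a≢a = contradiction refl a≢a

  update-there : ∀ σ a b {k} → k ≢ a → (σ [ a ↦ b ]) k ≡ σ k
  update-there σ a b {k} k≢a with em {k ≡ a}
  ... | yes k≡a = contradiction k≡a k≢a
  ... | no  _   = refl

  factorAt-cong : ∀ σ τ a a′ → σ a ≡ τ a → factorAt σ (a , a′) ≡ factorAt τ (a , a′)
  factorAt-cong σ τ a a′ = cong (maybe′ (λ b → indicator (em {b ≡ a′})) (factor (a , a′)))

  productAt-update-∉ : ∀ σ a b cs → a ∉ map proj₁ cs →
                       productAt (σ [ a ↦ b ]) cs ≡ productAt σ cs
  productAt-update-∉ σ a b [] a∉ = refl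
  productAt-update-∉ σ a b ((k , k′) ∷ cs) a∉ = cong₂ _*_
    (factorAt-cong (σ [ a ↦ b ]) σ k k′ (update-there σ a b λ { refl → a∉ (here refl) }))
    (productAt-update-∉ σ a b cs (a∉ ∘ there))

  -- The law of total probability, for the successor of an unassigned object.
  -- At most one constraint concerns a, since keys are distinct.

  average-product : ∀ {σ} a → σ a ≡ nothing → ∀ cs → Unique (map proj₁ cs) →
    ∑ (support a) (λ b → factor (a , b) * productAt (σ [ a ↦ b ]) cs) ≡ productAt σ cs
  average-product a σa≡ [] _ = trans (∑-*ʳ (support a) {λ b → factor (a , b)} 1ℚ)
    (trans (*-identityʳ (∑ (support a) (λ b → factor (a , b)))) (∑-factor a))
  average-product {σ} a σa≡ ((k , k′) ∷ cs) (k∉ ∷ u) = split em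
    where
    open ≡-Reasoning
    split : Dec (k ≡ a) →
      ∑ (support a) (λ b → factor (a , b) * productAt (σ [ a ↦ b ]) ((k , k′) ∷ cs)) ≡
      productAt σ ((k , k′) ∷ cs)
    split (yes refl) = begin
      ∑ (support a) (λ b → factor (a , b) * (factorAt (σ [ a ↦ b ]) (a , k′) * productAt (σ [ a ↦ b ]) cs))
        ≡⟨ ∑-cong (support a) (λ {b} _ → trans
             (cong₂ (λ x y → factor (a , b) * (x * y))
               (cong (maybe′ (λ b → indicator (em {b ≡ k′})) (factor (a , k′))) (update-here σ a b))
               (productAt-update-∉ σ a b cs λ a∈ → All.lookup k∉ a∈ refl))
             (sym (*-assoc (factor (a , b)) (indicator em) (productAt σ cs)))) ⟩
      ∑ (support a) (λ b → (factor (a , b) * indicator (em {b ≡ k′})) * productAt σ cs)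
        ≡⟨ ∑-*ʳ (support a) (productAt σ cs) ⟩
      ∑ (support a) (λ b → factor (a , b) * indicator (em {b ≡ k′})) * productAt σ cs
        ≡⟨ cong (_* productAt σ cs) (∑-indicator (λ _ _ → em) (λ b → factor (a , b)) (support a)
             (proj₁ (proj₂ (finite (proj₁ a)))) (factor≡0 a)) ⟩
      factor (a , k′) * productAt σ cs
        ≡⟨ cong (_* productAt σ cs) (cong (maybe′ (λ b → indicator (em {b ≡ k′})) (factor (a , k′))) σa≡) ⟨
      factorAt σ (a , k′) * productAt σ cs
        ∎
    split (no k≢a) = begin
      ∑ (support a) (λ b → factor (a , b) * (factorAt (σ [ a ↦ b ]) (k , k′) * productAt (σ [ a ↦ b ]) cs))
        ≡⟨ ∑-cong (support a) (λ {b} _ → trans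
             (cong (λ x → factor (a , b) * (x * productAt (σ [ a ↦ b ]) cs))
               (factorAt-cong (σ [ a ↦ b ]) σ k k′ (update-there σ a b k≢a)))
             (solve 3 (λ x y z → x :* (y :* z) := y :* (x :* z)) refl
               (factor (a , b)) (factorAt σ (k , k′)) (productAt (σ [ a ↦ b ]) cs))) ⟩
      ∑ (support a) (λ b → factorAt σ (k , k′) * (factor (a , b) * productAt (σ [ a ↦ b ]) cs))
        ≡⟨ ∑-*ˡ (factorAt σ (k , k′)) (support a) ⟩
      factorAt σ (k , k′) * ∑ (support a) (λ b → factor (a , b) * productAt (σ [ a ↦ b ]) cs)
        ≡⟨ cong (factorAt σ (k , k′) *_) (average-product a σa≡ cs u) ⟩
      factorAt σ (k , k′) * productAt σ cs
        ∎

  average-mass : ∀ {σ} a → σ a ≡ nothing → ∀ B →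
    ∑ (support a) (λ b → factor (a , b) * massAt (σ [ a ↦ b ]) B) ≡ massAt σ B
  average-mass a σa≡ (just B) = average-product a σa≡ (constraints B) (distinct B)
  average-mass a σa≡ nothing  = trans (∑-*ʳ (support a) {λ b → factor (a , b)} 0ℚ)
    (*-zeroʳ (∑ (support a) (λ b → factor (a , b))))

  module _ (C : Family) (q : ℚ) where

    -- The total of C, conditional on σ, is at most q.

    Bounded : Assignment → Set
    Bounded σ = ∀ n → ∑< n (massAt σ ∘ C) ≤ q

    -- Otherwise, for each of the finitely many successors b, the partial sums
    -- of the conditional total eventually exceed q; then so does their mean
    -- at a common index, which is a partial sum conditional on σ.

    extend : ∀ {σ} a → σ a ≡ nothing → Bounded σ →
             ∃[ b ] b ∈ support a × Bounded (σ [ a ↦ b ])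
    extend {σ} a σa≡ bounded with em {∃[ b ] b ∈ support a × Bounded (σ [ a ↦ b ])}
    ... | yes found = found
    ... | no  none  = contradiction
      (≤-<-trans (bounded N) (subst (q <_) average
        (mean> (support a) {v = λ b → sums b N} (factor-pos a) exceeds (∑-factor a))))
      (<-irrefl refl)
      where
      sums : Λ → ℕ → ℚ
      sums b n = ∑< n (massAt (σ [ a ↦ b ]) ∘ C)

      exceeds-eventually : ∀ {b} → b ∈ support a → ∃[ N ] (∀ n → N ℕ.≤ n → q < sums b n)
      exceeds-eventually {b} b∈ with em {∃[ N ] q < sums b N}
      ... | yes (N , q<) = N , λ n N≤n →
        <-≤-trans q< (∑<-mono-index (massAt-nonNeg (σ [ a ↦ b ]) ∘ C) (ℕ.≤⇒≤′ N≤n))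
      ... | no  never    = contradiction (b , b∈ , λ n → ≮⇒≥ λ q< → never (n , q<)) none

      common = eventually-all (support a) exceeds-eventually
      N = proj₁ common

      exceeds : ∀ {b} → b ∈ support a → q < sums b N
      exceeds = proj₂ common

      average : ∑ (support a) (λ b → factor (a , b) * sums b N) ≡ ∑< N (massAt σ ∘ C)
      average = begin
        ∑ (support a) (λ b → factor (a , b) * sums b N)
          ≡⟨ ∑-cong (support a) (λ {b} _ → ∑-*ˡ (factor (a , b)) (downFrom N)) ⟨
        ∑ (support a) (λ b → ∑< N (λ n → factor (a , b) * massAt (σ [ a ↦ b ]) (C n)))
          ≡⟨ ∑-swap (support a) (downFrom N) _ ⟩
        ∑< N (λ n → ∑ (support a) (λ b → factor (a , b) * massAt (σ [ a ↦ b ]) (C n)))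
          ≡⟨ ∑-cong (downFrom N) (λ {n} _ → average-mass a σa≡ (C n)) ⟩
        ∑< N (massAt σ ∘ C)
          ∎
        where open ≡-Reasoning

    -- A partial assignment of successors that keeps the conditional total at
    -- most q.

    record Stage : Set where
      field
        σ       : Assignment
        valid   : ∀ a {b} → σ a ≡ just b → w (proj₁ a) b ≢ 0
        bounded : Bounded σ
    open Stage

    -- Extension of assignments.

    infix 4 _⊑_
    _⊑_ : Stage → Stage → Set
    s ⊑ t = ∀ a {b} → σ s a ≡ just b → σ t a ≡ just b

    Assigned : Stage → Λ⁺ → Set
    Assigned s a = ∃[ b ] σ s a ≡ just b

    assign : ∀ s a → ∃[ t ] s ⊑ t × Assigned t a
    assign s a with σ s a in σa≡
    ... | just b  = s , (λ _ → id) , b , σa≡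
    ... | nothing = t , s⊑t , b , update-here (σ s) a b
      where
      extension = extend a σa≡ (bounded s)
      b = proj₁ extension

      valid′ : ∀ k {b′} → (σ s [ a ↦ b ]) k ≡ just b′ → w (proj₁ k) b′ ≢ 0
      valid′ k eq with em {k ≡ a}
      valid′ k refl | yes refl = support⇒w≢0 a (proj₁ (proj₂ extension))
      valid′ k eq   | no  _    = valid s k eq

      t : Stage
      t = record { σ = σ s [ a ↦ b ] ; valid = valid′ ; bounded = proj₂ (proj₂ extension) }

      s⊑t : s ⊑ t
      s⊑t k eq = trans (update-there (σ s) a b λ { refl → contradiction (trans (sym eq) σa≡) λ () }) eq

    assignAll : ∀ s as → ∃[ t ] s ⊑ t × All (Assigned t) as
    assignAll s []       = s , (λ _ → id) , []
    assignAll s (a ∷ as) =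
      let t , s⊑t , b , eq = assign s a
          u , t⊑u , all    = assignAll t as
      in u , (λ k → t⊑u k ∘ s⊑t k) , (b , t⊑u a eq) ∷ all

    -- The objects that a box constrains.

    keys : Maybe Box → List Λ⁺
    keys = maybe′ (map proj₁ ∘ constraints) []

    module _ (initially : ∀ n → ∑< n (mass ∘ C) ≤ q) where

      -- Stage n assigns the objects constrained by the boxes before index n.

      stage : ℕ → Stage
      stage zero    = record { σ = unassigned ; valid = λ _ () ; bounded = initially }
      stage (suc n) = proj₁ (assignAll (stage n) (keys (C n)))

      stage-mono : ∀ {m n} → m ℕ.≤′ n → stage m ⊑ stage n
      stage-mono ℕ.≤′-refl           a eq = eq
      stage-mono (ℕ.≤′-step {n} m≤n) a eq =
        proj₁ (proj₂ (assignAll (stage n) (keys (C n)))) a (stage-mono m≤n a eq)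

      stage-consistent : ∀ m n a {b b′} → σ (stage m) a ≡ just b → σ (stage n) a ≡ just b′ → b ≡ b′
      stage-consistent m n a eq eq′ = just-injective (trans
        (sym (stage-mono (ℕ.≤⇒≤′ (ℕ.m≤m⊔n m n)) a eq))
        (stage-mono (ℕ.≤⇒≤′ (ℕ.m≤n⊔m m n)) a eq′))

      support-inhabited : ∀ a → ∃[ b ] b ∈ support a
      support-inhabited a = inhabited (support a) (∑-factor a)
        where
        inhabited : ∀ (xs : List Λ) {f} → ∑ xs f ≡ 1ℚ → ∃[ b ] b ∈ xs
        inhabited (b ∷ _) _ = b , here refl

      -- The value assigned to a at some stage, or else any successor of a.

      successor : ∀ a → ∃[ b ] w (proj₁ a) b ≢ 0
      successor a with em {∃[ n ] Assigned (stage n) a}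
      ... | yes (n , b , eq) = b , valid (stage n) a eq
      ... | no  _            = let b , b∈ = support-inhabited a in b , support⇒w≢0 a b∈

      -- The strategy that extends all the stages.

      limit : Strategy
      limit = record { next = proj₁ ∘ successor ; step = proj₂ ∘ successor }

      next-limit : ∀ n a {b} → σ (stage n) a ≡ just b → next limit a ≡ b
      next-limit n a eq with em {∃[ n ] Assigned (stage n) a}
      ... | yes (m , b , eq′) = stage-consistent m n a eq′ eq
      ... | no  never         = contradiction (n , _ , eq) never

      limit∈⇒mass≡1 : ∀ n {B} → C n ≡ just B → ⟦ B ⟧ ∋ limit → massAt (σ (stage (suc n))) (C n) ≡ 1ℚ
      limit∈⇒mass≡1 n {B} Cn≡ lim∈B = trans (cong (massAt t) Cn≡)
        (productAt-satisfied t (All.zipWith satisfied (All.map⁻ assigned , lim∈B)))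
        where
        t = σ (stage (suc n))

        assigned : All (Assigned (stage (suc n))) (keys (just B))
        assigned = subst (All (Assigned (stage (suc n))) ∘ keys) Cn≡
          (proj₂ (proj₂ (assignAll (stage n) (keys (C n)))))

        satisfied : ∀ {c} → Assigned (stage (suc n)) (proj₁ c) × next limit (proj₁ c) ≡ proj₂ c →
                    t (proj₁ c) ≡ just (proj₂ c)
        satisfied {a , _} ((b , eq) , lim≡) =
          trans eq (cong just (trans (sym (next-limit (suc n) a eq)) lim≡))

      not-covering : q < 1ℚ → ¬ Covers C full
      not-covering q<1 covers =
        let n , B , Cn≡ , lim∈B = covers {limit} _
            s = σ (stage (suc n))
        in <-irrefl refl (≤-<-trans
             (≤-trans (≤-reflexive (sym (limit∈⇒mass≡1 n Cn≡ lim∈B)))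
               (≤-trans (term≤∑ (massAt-nonNeg s ∘ C) (∈-downFrom⁺ (ℕ.n<1+n n)))
                 (bounded (stage (suc n)) (suc n))))
             q<1)

  P-full≥1 : 1∞ ≤∞ P full
  P-full≥1 {r} r<1 =
    let q , r<q , q<1 = <-dense r<1 in
    q , r<q , λ (C , covers) → decidable-stable em λ q≮C →
      not-covering C q (λ n → ≮⇒≥ λ q<∑ → q≮C (proj₂ (total-≐ C) (n , q<∑)))
        q<1 (λ {f} → covers {f})

theorem3p11 : ExcludedMiddle 0ℓ →
    (Λ : Set) (w : Λ → Λ → ℕ)
    (finite : ∀ a → IsFinite (λ b → w a b ≢ 0)) →
    let open Strategies Λ w finite in
    IsProbabilitySpace Ω Measurable (λ A _ → P A)
theorem3p11 em Λ w finite = record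
  { isσAlgebra = record
    { 𝒜-resp-≐ = λ {A} {B} → meas-resp-≐ {A} {B}
    ; full∈𝒜   = meas-full
    ; ∁∈𝒜      = λ {A} → meas-∁ {A}
    ; ⋃∈𝒜      = λ {A} → meas-⋃ {A}
    }
  ; μ-cong     = λ {A} {B} _ _ (A⊆B , B⊆A) → P-mono {A} {B} A⊆B , P-mono {B} {A} B⊆A
  ; μ≤1        = λ {A} _ → P-full≤1 ∘ P-mono {A} {full} (λ _ → _)
  ; μ-∅        = λ _ → P-∅
  ; σ-additive = λ {A} → μ-σ-additive {A}
  ; μ-full     = P-full≤1 , P-full≥1
  }
  where
  open Strategies Λ w finite
  open OuterMeasure em Λ w finite
  open TotalMass em Λ w finite
  open Carathéodory em P (λ {A} {B} → P-mono {A} {B}) (proj₁ P-∅) P-subadditive
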